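{- Let $p=q=1/2$ and let $X_{n,s}$ be the number of turns required to end the single-player pile game with boundary with set of choices $R=\{1,-1\}$ and target $n$, starting with $s$ chips, $0\le s\le n$. Then $$E[X_{n,s}^2]=\frac{(n-s)(n+s+1)(5n^2+5n-s^2-s-1)}{3},$$ $$E[X_{n,s}^3]=\frac{(n-s)(n+s+1)}{15}\Bigl(61n^4+122n^3-(14s^2+14s-38)n^2-(14s^2+14s+23)n+s^4+2s^3+8s^2+7s-3\Bigr).$$
   Context: Single-player pile game with boundary, $R=\{1,-1\}$: the player starts with $s$ chips, $0\le s\le n$. In each turn, independently, with probability $p$ one chip is added, and with probability $q=1-p$ one chip is removed, except that if the player has $0$ chips he stays at $0$ instead. The game ends when the player first has $n$ chips (at turn $0$ if $s=n$). -}

module Defs where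

open import Data.Integer.Base using (+_)
open import Data.List.Base as List using (List; []; _∷_; _++_; filter; foldr)
open import Data.Nat.Base as ℕ using (ℕ; zero; suc; _≥_)
open import Data.Nat.Properties using (_≟_)
open import Data.Product.Base using (∃-syntax; _×_)
open import Data.Rational.Base
  using (ℚ; 0ℚ; 1ℚ; _+_; _-_; _*_; _/_; _<_; ∣_∣)
open import Data.Vec.Base as Vec using (Vec; []; _∷_)
open import Relation.Binary.PropositionalEquality using (_≢_; refl)
open import Relation.Nullary.Decidable using (Dec; yes; no)

-- The set of choices R = {1, -1}.
data Choice : Set where
  +1# -1# : Choice

move : Choice → ℕ → ℕ
move +1# c       = suc c
move -1# zero    = zero
move -1# (suc c) = c

-- EndsAfter n s w: starting with s chips and making the choices w in order,
-- the player has n chips after the last choice of w and at no earlier time.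
-- The event X_{n,s} = t depends only on the first t choices, and it occurs
-- exactly when the word w of length t that they form satisfies EndsAfter n s w.
data EndsAfter (n : ℕ) : ∀ {t} → ℕ → Vec Choice t → Set where
  stop : EndsAfter n n []
  turn : ∀ {t s c} {w : Vec Choice t} →
         s ≢ n → EndsAfter n (move c s) w → EndsAfter n s (c ∷ w)

endsAfter? : ∀ n s {t} (w : Vec Choice t) → Dec (EndsAfter n s w)
endsAfter? n s [] with s ≟ n
... | yes refl = yes stop
... | no  s≢n      = no λ { stop → s≢n refl }
endsAfter? n s (c ∷ w) with s ≟ n
... | yes s≡n = no λ { (turn s≢n _) → s≢n s≡n }
... | no  s≢n with endsAfter? n (move c s) w
...   | yes e = yes (turn s≢n e)
...   | no ¬e = no λ { (turn _ e) → ¬e e }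

words : ∀ t → List (Vec Choice t)
words zero    = [] ∷ []
words (suc t) = List.map (+1# ∷_) (words t) ++ List.map (-1# ∷_) (words t)

-- Choices are independent, +1# having probability p and -1# probability 1 - p.
choiceProb : ℚ → Choice → ℚ
choiceProb p +1# = p
choiceProb p -1# = 1ℚ - p

wordProb : ∀ {t} → ℚ → Vec Choice t → ℚ
wordProb p []      = 1ℚ
wordProb p (c ∷ w) = choiceProb p c * wordProb p w

-- P(X_{n,s} = t).
turnsProb : (p : ℚ) (n s : ℕ) → ℕ → ℚ
turnsProb p n s t =
  foldr _+_ 0ℚ (List.map (wordProb p) (filter (endsAfter? n s) (words t)))

partialSum : (ℕ → ℚ) → ℕ → ℚ
partialSum f zero    = 0ℚ
partialSum f (suc m) = partialSum f m + f m

-- The terms and the sum are rational, so it suffices to let ε range over the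
-- positive rationals.
SumsTo : (ℕ → ℚ) → ℚ → Set
SumsTo f l =
  ∀ ε → 0ℚ < ε → ∃[ N ] (∀ m → m ≥ N → ∣ partialSum f m - l ∣ < ε)

-- E[X^k] = e for a random variable X with values in ℕ ∪ {∞} and
-- P(X = t) = prob t. The first condition says that X is almost surely finite;
-- without it the series would ignore the event X = ∞.
IsMoment : (prob : ℕ → ℚ) (k : ℕ) (e : ℚ) → Set
IsMoment prob k e =
  SumsTo prob 1ℚ × SumsTo (λ t → (+ (t ℕ.^ k) / 1) * prob t) e

{-# OPTIONS --safe #-}
module Submission where

-- Let g r s = E[(r + X_{n,s})^k], where r counts the turns already made. It equals
-- r^k at s = n and is elsewhere the mean of its two values one turn later, so the
-- partial sum of Σ (r + t)^k P(X_{n,s} = t) up to t < m differs from g r s by the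
-- mean of g (r + m) over the walks still running after m turns. That remainder is
-- controlled without any estimate of the survival probability: h is nonnegative
-- and does not increase in mean along the walk, and M * ∣ g M s ∣ ≤ h M s, so
-- M = r + m times the remainder is at most h r s. For all k ≤ 3 the polynomial
-- h = y⁴ + 8 w y³ works, where w = E[X_{n,s}] = n (n + 1) - s (s + 1) and
-- y = r + 6 (n (n + 1) + 1).

open import Data.Integer.Base using (+_; _+_; _-_; _*_; _^_)
open import Data.Nat.Base using (ℕ; _≤_)
open import Data.Product.Base using (_×_)
open import Data.Rational.Base using (½; _/_)
open import Defs

open import Data.Empty using (⊥-elim)
open import Data.Integer.Base using (ℤ)
import Data.Integer.Base as ℤ
import Data.Integer.Properties as ℤₚ
open import Data.Integer.Solver using (module +-*-Solver)
open import Data.List.Base as List using (List; []; _∷_; _++_; filter; foldr)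
open import Data.List.Properties using (filter-++; map-++)
open import Data.Nat.Base using (zero; suc; _<_; _∸_; z≤n; s≤s)
import Data.Nat.Base as ℕ
import Data.Nat.Properties as ℕₚ
open import Data.Nat.Solver using () renaming (module +-*-Solver to ℕ-Solver)
import Data.Nat.Tactic.RingSolver as ℕ-Ring
open import Data.Product.Base using (_,_; ∃-syntax)
open import Data.Rational.Base using (ℚ; 0ℚ; 1ℚ; mkℚ; fromℚᵘ; toℚᵘ)
import Data.Rational.Base as ℚ
import Data.Rational.Properties as ℚₚ
open import Data.Rational.Unnormalised.Base using (mkℚᵘ; *≡*; *≤*; *<*)
import Data.Rational.Unnormalised.Base as ℚᵘ
import Data.Rational.Unnormalised.Properties as ℚᵘₚ
open import Data.Rational.Solver using () renaming (module +-*-Solver to ℚ-Solver)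
open import Data.Sum.Base using (inj₁; inj₂)
open import Data.Vec.Base using (Vec; _∷_)
open import Function.Base using (_∘_)
open import Relation.Binary.PropositionalEquality
open import Relation.Nullary using (yes; no)

-- Fractions, absolute values and the Archimedean property

fromℚᵘ-homo-+ : ∀ p q → fromℚᵘ (p ℚᵘ.+ q) ≡ fromℚᵘ p ℚ.+ fromℚᵘ q
fromℚᵘ-homo-+ p q = ℚₚ.toℚᵘ-injective (begin
  toℚᵘ (fromℚᵘ (p ℚᵘ.+ q))                 ≈⟨ ℚₚ.toℚᵘ-fromℚᵘ (p ℚᵘ.+ q) ⟩
  p ℚᵘ.+ q                                 ≈⟨ ℚᵘₚ.+-cong (ℚₚ.toℚᵘ-fromℚᵘ p) (ℚₚ.toℚᵘ-fromℚᵘ q) ⟨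
  toℚᵘ (fromℚᵘ p) ℚᵘ.+ toℚᵘ (fromℚᵘ q)     ≈⟨ ℚₚ.toℚᵘ-homo-+ (fromℚᵘ p) (fromℚᵘ q) ⟨
  toℚᵘ (fromℚᵘ p ℚ.+ fromℚᵘ q)             ∎)
  where open ℚᵘₚ.≃-Reasoning

fromℚᵘ-homo-* : ∀ p q → fromℚᵘ (p ℚᵘ.* q) ≡ fromℚᵘ p ℚ.* fromℚᵘ q
fromℚᵘ-homo-* p q = ℚₚ.toℚᵘ-injective (begin
  toℚᵘ (fromℚᵘ (p ℚᵘ.* q))                 ≈⟨ ℚₚ.toℚᵘ-fromℚᵘ (p ℚᵘ.* q) ⟩
  p ℚᵘ.* q                                 ≈⟨ ℚᵘₚ.*-cong (ℚₚ.toℚᵘ-fromℚᵘ p) (ℚₚ.toℚᵘ-fromℚᵘ q) ⟨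
  toℚᵘ (fromℚᵘ p) ℚᵘ.* toℚᵘ (fromℚᵘ q)     ≈⟨ ℚₚ.toℚᵘ-homo-* (fromℚᵘ p) (fromℚᵘ q) ⟨
  toℚᵘ (fromℚᵘ p ℚ.* fromℚᵘ q)             ∎)
  where open ℚᵘₚ.≃-Reasoning

fromℚᵘ-∣-∣ : ∀ p → fromℚᵘ ℚᵘ.∣ p ∣ ≡ ℚ.∣ fromℚᵘ p ∣
fromℚᵘ-∣-∣ p = ℚₚ.toℚᵘ-injective (begin
  toℚᵘ (fromℚᵘ ℚᵘ.∣ p ∣)     ≈⟨ ℚₚ.toℚᵘ-fromℚᵘ ℚᵘ.∣ p ∣ ⟩
  ℚᵘ.∣ p ∣                   ≈⟨ ℚᵘₚ.∣-∣-cong (ℚₚ.toℚᵘ-fromℚᵘ p) ⟨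
  ℚᵘ.∣ toℚᵘ (fromℚᵘ p) ∣     ≈⟨ ℚₚ.toℚᵘ-homo-∣-∣ (fromℚᵘ p) ⟨
  toℚᵘ ℚ.∣ fromℚᵘ p ∣        ∎)
  where open ℚᵘₚ.≃-Reasoning

fromℚᵘ-mono-≤ : ∀ p q → p ℚᵘ.≤ q → fromℚᵘ p ℚ.≤ fromℚᵘ q
fromℚᵘ-mono-≤ p q p≤q = ℚₚ.toℚᵘ-cancel-≤ (begin
  toℚᵘ (fromℚᵘ p)   ≃⟨ ℚₚ.toℚᵘ-fromℚᵘ p ⟩
  p                 ≤⟨ p≤q ⟩
  q                 ≃⟨ ℚₚ.toℚᵘ-fromℚᵘ q ⟨
  toℚᵘ (fromℚᵘ q)   ∎)
  where open ℚᵘₚ.≤-Reasoning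

fromℚᵘ-mono-< : ∀ p q → p ℚᵘ.< q → fromℚᵘ p ℚ.< fromℚᵘ q
fromℚᵘ-mono-< p q p<q = ℚₚ.toℚᵘ-cancel-< (begin-strict
  toℚᵘ (fromℚᵘ p)   ≃⟨ ℚₚ.toℚᵘ-fromℚᵘ p ⟩
  p                 <⟨ p<q ⟩
  q                 ≃⟨ ℚₚ.toℚᵘ-fromℚᵘ q ⟨
  toℚᵘ (fromℚᵘ q)   ∎)
  where open ℚᵘₚ.≤-Reasoning

fromℕ : ℕ → ℚ
fromℕ m = + m / 1

-- `fromℚᵘ (mkℚᵘ i d)` computes to `i / suc d`, so a single cross-multiplication of unnormalised
-- fractions is enough.
/-homo-+ : ∀ d i j → (i + j) / suc d ≡ i / suc d ℚ.+ j / suc d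
/-homo-+ d i j = trans (ℚₚ.fromℚᵘ-cong {mkℚᵘ (i + j) d} {mkℚᵘ i d ℚᵘ.+ mkℚᵘ j d} (*≡* cross))
                       (fromℚᵘ-homo-+ (mkℚᵘ i d) (mkℚᵘ j d))
  where
  cross : (i + j) * + (suc d ℕ.* suc d) ≡ (i * + suc d + j * + suc d) * + suc d
  cross = trans (cong ((i + j) *_) (ℤₚ.pos-* (suc d) (suc d)))
    (solve 3 (λ i j D → (i :+ j) :* (D :* D) := (i :* D :+ j :* D) :* D) refl i j (+ suc d))
    where open +-*-Solver

fromℕ-mono-≤ : ∀ {i j} → i ≤ j → fromℕ i ℚ.≤ fromℕ j
fromℕ-mono-≤ {i} {j} i≤j = fromℚᵘ-mono-≤ (mkℚᵘ (+ i) 0) (mkℚᵘ (+ j) 0) (*≤* (ℤₚ.*-monoʳ-≤-nonNeg (+ 1) (ℤ.+≤+ i≤j)))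

fromℕ-nonNeg : ∀ m → ℚ.NonNegative (fromℕ m)
fromℕ-nonNeg m = ℚₚ.normalize-nonNeg m 1

fromℕ*∣/∣≤fromℕ : ∀ m i d k → m ℕ.* ℤ.∣ i ∣ ≤ k ℕ.* suc d → fromℕ m ℚ.* ℚ.∣ i / suc d ∣ ℚ.≤ fromℕ k
fromℕ*∣/∣≤fromℕ m i d k mi≤kd = begin
  fromℕ m ℚ.* ℚ.∣ i / suc d ∣
    ≡⟨ cong (fromℕ m ℚ.*_) (fromℚᵘ-∣-∣ (mkℚᵘ i d)) ⟨
  fromℕ m ℚ.* fromℚᵘ ℚᵘ.∣ mkℚᵘ i d ∣
    ≡⟨ fromℚᵘ-homo-* (mkℚᵘ (+ m) 0) ℚᵘ.∣ mkℚᵘ i d ∣ ⟨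
  fromℚᵘ (mkℚᵘ (+ m) 0 ℚᵘ.* ℚᵘ.∣ mkℚᵘ i d ∣)
    ≤⟨ fromℚᵘ-mono-≤ (mkℚᵘ (+ m) 0 ℚᵘ.* ℚᵘ.∣ mkℚᵘ i d ∣) (mkℚᵘ (+ k) 0) (*≤* cross) ⟩
  fromℕ k ∎
  where
  open ℚₚ.≤-Reasoning
  cross : + m * + ℤ.∣ i ∣ * + 1 ℤ.≤ + k * + (1 ℕ.* suc d)
  cross = subst₂ ℤ._≤_
    (sym (trans (ℤₚ.*-identityʳ _) (sym (ℤₚ.pos-* m ℤ.∣ i ∣))))
    (trans (ℤₚ.pos-* k (suc d)) (cong (λ x → + k * + x) (sym (ℕₚ.*-identityˡ (suc d)))))
    (ℤ.+≤+ mi≤kd)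

archimedean : ∀ k ε → 0ℚ ℚ.< ε → ∃[ N ] (∀ m → N ≤ m → fromℕ k ℚ.< fromℕ m ℚ.* ε)
archimedean k ε 0<ε = below ε (ℚ.positive 0<ε)
  where
  below : ∀ ε → ℚ.Positive ε → ∃[ N ] (∀ m → N ≤ m → fromℕ k ℚ.< fromℕ m ℚ.* ε)
  -- For ε = (a + 1) / (b + 1) the witness exceeds k (b + 1), and m (a + 1) ≥ m. Positivity rules
  -- out all other numerators.
  below ε@(mkℚ (+ suc a) b _) _ = suc (k ℕ.* suc b) , λ m N≤m →
    let
      k[b+1]<m[a+1] : k ℕ.* suc b < m ℕ.* suc a
      k[b+1]<m[a+1] = ℕₚ.≤-trans N≤m (ℕₚ.m≤m*n m (suc a))
      cross : + k * + (1 ℕ.* suc b) ℤ.< + m * + suc a * + 1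
      cross = subst₂ ℤ._<_
        (trans (ℤₚ.pos-* k (suc b)) (cong (λ x → + k * + x) (sym (ℕₚ.*-identityˡ (suc b)))))
        (sym (trans (ℤₚ.*-identityʳ _) (sym (ℤₚ.pos-* m (suc a)))))
        (ℤ.+<+ k[b+1]<m[a+1])
    in subst (fromℕ k ℚ.<_)
      (trans (fromℚᵘ-homo-* (mkℚᵘ (+ m) 0) (toℚᵘ ε)) (cong (fromℕ m ℚ.*_) (ℚₚ.fromℚᵘ-toℚᵘ ε)))
      (fromℚᵘ-mono-< (mkℚᵘ (+ k) 0) (mkℚᵘ (+ m) 0 ℚᵘ.* toℚᵘ ε) (*<* cross))

-- Partial sums

partialSum-cong : ∀ {f g} → (∀ t → f t ≡ g t) → ∀ m → partialSum f m ≡ partialSum g m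
partialSum-cong f≗g zero    = refl
partialSum-cong f≗g (suc m) = cong₂ ℚ._+_ (partialSum-cong f≗g m) (f≗g m)

-- `partialSum` grows at the end, while conditioning on the first turn needs the term at 0 split
-- off.
partialSum-suc : ∀ f m → partialSum f (suc m) ≡ f 0 ℚ.+ partialSum (f ∘ suc) m
partialSum-suc f zero    = ℚₚ.+-comm 0ℚ (f 0)
partialSum-suc f (suc m) = begin
  partialSum f (suc m) ℚ.+ f (suc m)                   ≡⟨ cong (ℚ._+ f (suc m)) (partialSum-suc f m) ⟩
  (f 0 ℚ.+ partialSum (f ∘ suc) m) ℚ.+ f (suc m)       ≡⟨ ℚₚ.+-assoc (f 0) _ _ ⟩
  f 0 ℚ.+ partialSum (f ∘ suc) (suc m)                 ∎
  where open ≡-Reasoning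

partialSum-zero : ∀ f → (∀ t → f t ≡ 0ℚ) → ∀ m → partialSum f m ≡ 0ℚ
partialSum-zero f f≗0 zero    = refl
partialSum-zero f f≗0 (suc m) = cong₂ ℚ._+_ (partialSum-zero f f≗0 m) (f≗0 m)

partialSum-average : ∀ f g m →
  partialSum (λ t → ½ ℚ.* f t ℚ.+ ½ ℚ.* g t) m ≡ ½ ℚ.* partialSum f m ℚ.+ ½ ℚ.* partialSum g m
partialSum-average f g zero    = refl
partialSum-average f g (suc m) = trans
  (cong (ℚ._+ (½ ℚ.* f m ℚ.+ ½ ℚ.* g m)) (partialSum-average f g m))
  (solve 5 (λ h a b x y → (h :* a :+ h :* b) :+ (h :* x :+ h :* y) := h :* (a :+ x) :+ h :* (b :+ y))
    refl ½ (partialSum f m) (partialSum g m) (f m) (g m))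
  where open ℚ-Solver

SumsTo-cong : ∀ {f g l} → (∀ t → f t ≡ g t) → SumsTo f l → SumsTo g l
SumsTo-cong {l = l} f≗g f→l ε 0<ε with f→l ε 0<ε
... | N , close = N , λ m N≤m →
  subst (λ x → ℚ.∣ x ℚ.- l ∣ ℚ.< ε) (partialSum-cong f≗g m) (close m N≤m)

-- Conditioning on the first turn

sumℚ : List ℚ → ℚ
sumℚ = foldr ℚ._+_ 0ℚ

sumℚ-++ : ∀ xs ys → sumℚ (xs ++ ys) ≡ sumℚ xs ℚ.+ sumℚ ys
sumℚ-++ []       ys = sym (ℚₚ.+-identityˡ _)
sumℚ-++ (x ∷ xs) ys = trans (cong (x ℚ.+_) (sumℚ-++ xs ys)) (sym (ℚₚ.+-assoc x _ _))

module _ (p : ℚ) (n : ℕ) where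

  -- `turnsProb p n s t` with `words t` replaced by an arbitrary list, so that induction on the list
  -- is possible.
  weight : ℕ → ∀ {t} → List (Vec Choice t) → ℚ
  weight s ws = sumℚ (List.map (wordProb p) (filter (endsAfter? n s) ws))

  weight-++ : ∀ s {t} (vs ws : List (Vec Choice t)) → weight s (vs ++ ws) ≡ weight s vs ℚ.+ weight s ws
  weight-++ s vs ws = begin
    weight s (vs ++ ws)
      ≡⟨ cong (sumℚ ∘ List.map (wordProb p)) (filter-++ (endsAfter? n s) vs ws) ⟩
    sumℚ (List.map (wordProb p) (filter (endsAfter? n s) vs ++ filter (endsAfter? n s) ws))
      ≡⟨ cong sumℚ (map-++ (wordProb p) (filter (endsAfter? n s) vs) _) ⟩
    sumℚ (List.map (wordProb p) (filter (endsAfter? n s) vs) ++ List.map (wordProb p) (filter (endsAfter? n s) ws))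
      ≡⟨ sumℚ-++ (List.map (wordProb p) (filter (endsAfter? n s) vs)) _ ⟩
    weight s vs ℚ.+ weight s ws ∎
    where open ≡-Reasoning

  -- Away from `n` the filter keeps `c ∷ w` exactly when it keeps `w` from the next position, and
  -- independence lets the probability of `c` factor out.
  weight-∷ : ∀ {s} → s ≢ n → ∀ c {t} (ws : List (Vec Choice t)) →
             weight s (List.map (c ∷_) ws) ≡ choiceProb p c ℚ.* weight (move c s) ws
  weight-∷ s≢n c [] = sym (ℚₚ.*-zeroʳ (choiceProb p c))
  weight-∷ {s} s≢n c (w ∷ ws) with s ℕₚ.≟ n
  ... | yes s≡n = ⊥-elim (s≢n s≡n)
  ... | no  _ with endsAfter? n (move c s) w
  ...   | yes _ = trans (cong (choiceProb p c ℚ.* wordProb p w ℚ.+_) (weight-∷ s≢n c ws))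
                        (sym (ℚₚ.*-distribˡ-+ (choiceProb p c) (wordProb p w) (weight (move c s) ws)))
  ...   | no  _ = weight-∷ s≢n c ws

  -- At `n` only the empty word ends the game in time, so the filter drops every nonempty one.
  weight-∷-ended : ∀ c {t} (ws : List (Vec Choice t)) → weight n (List.map (c ∷_) ws) ≡ 0ℚ
  weight-∷-ended c [] = refl
  weight-∷-ended c (w ∷ ws) with n ℕₚ.≟ n
  ... | yes _   = weight-∷-ended c ws
  ... | no  n≢n = ⊥-elim (n≢n refl)

  turnsProb-ended-zero : turnsProb p n n 0 ≡ 1ℚ
  turnsProb-ended-zero with n ℕₚ.≟ n
  ... | yes refl = refl
  ... | no  n≢n  = ⊥-elim (n≢n refl)

  turnsProb-ended-suc : ∀ t → turnsProb p n n (suc t) ≡ 0ℚ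
  turnsProb-ended-suc t = trans (weight-++ n (List.map (+1# ∷_) (words t)) _)
    (cong₂ ℚ._+_ (weight-∷-ended +1# (words t)) (weight-∷-ended -1# (words t)))

  turnsProb-zero : ∀ {s} → s ≢ n → turnsProb p n s 0 ≡ 0ℚ
  turnsProb-zero {s} s≢n with s ℕₚ.≟ n
  ... | yes s≡n = ⊥-elim (s≢n s≡n)
  ... | no  _   = refl

  turnsProb-suc : ∀ {s} → s ≢ n → ∀ t →
    turnsProb p n s (suc t) ≡ p ℚ.* turnsProb p n (suc s) t ℚ.+ (1ℚ ℚ.- p) ℚ.* turnsProb p n (move -1# s) t
  turnsProb-suc {s} s≢n t = trans (weight-++ s (List.map (+1# ∷_) (words t)) _)
    (cong₂ ℚ._+_ (weight-∷ s≢n +1# (words t)) (weight-∷ s≢n -1# (words t)))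

-- Convergence from a mean-value function and a majorant

move-down-≤ : ∀ s → move -1# s ≤ s
move-down-≤ zero    = z≤n
move-down-≤ (suc s) = ℕₚ.n≤1+n s

-- The mean conditions are doubled to avoid `½`: `h` can then take values in `ℕ`, and the condition
-- on `g` becomes an identity between integer numerators.
module Approximation
  (n : ℕ) (a : ℕ → ℚ) (g : ℕ → ℕ → ℚ) (h : ℕ → ℕ → ℕ)
  (g-ended : ∀ r → g r n ≡ a r)
  (g-mean : ∀ r {s} → s < n → g r s ℚ.+ g r s ≡ g (suc r) (suc s) ℚ.+ g (suc r) (move -1# s))
  (h-mean : ∀ r {s} → s < n → h (suc r) (suc s) ℕ.+ h (suc r) (move -1# s) ≤ h r s ℕ.+ h r s)
  (g≤h : ∀ r {s} → s ≤ n → fromℕ r ℚ.* ℚ.∣ g r s ∣ ℚ.≤ fromℕ (h r s))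
  where

  term : ℕ → ℕ → ℕ → ℚ
  term r s t = a (r ℕ.+ t) ℚ.* turnsProb ½ n s t

  error : ℕ → ℕ → ℕ → ℚ
  error r s m = partialSum (term r s) m ℚ.- g r s

  error-zero : ∀ r s → ℚ.∣ error r s 0 ∣ ≡ ℚ.∣ g r s ∣
  error-zero r s = trans (cong ℚ.∣_∣ (ℚₚ.+-identityˡ (ℚ.- g r s))) (ℚₚ.∣-p∣≡∣p∣ (g r s))

  -- The term at `t = 0` already equals `g r n` and all later ones vanish. With no terms the error
  -- would be `- g r n`, hence `suc m`.
  error-ended : ∀ r m → error r n (suc m) ≡ 0ℚ
  error-ended r m = begin
    partialSum (term r n) (suc m) ℚ.- g r n
      ≡⟨ cong₂ ℚ._-_ (partialSum-suc (term r n) m) (g-ended r) ⟩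
    (term r n 0 ℚ.+ partialSum (term r n ∘ suc) m) ℚ.- a r
      ≡⟨ cong (ℚ._- a r) (cong₂ ℚ._+_
           (trans (cong₂ ℚ._*_ (cong a (ℕₚ.+-identityʳ r)) (turnsProb-ended-zero ½ n)) (ℚₚ.*-identityʳ (a r)))
           (partialSum-zero (term r n ∘ suc) (λ t →
             trans (cong (a (r ℕ.+ suc t) ℚ.*_) (turnsProb-ended-suc ½ n t)) (ℚₚ.*-zeroʳ (a (r ℕ.+ suc t)))) m)) ⟩
    (a r ℚ.+ 0ℚ) ℚ.- a r
      ≡⟨ cong (ℚ._- a r) (ℚₚ.+-identityʳ (a r)) ⟩
    a r ℚ.- a r
      ≡⟨ ℚₚ.+-inverseʳ (a r) ⟩
    0ℚ ∎
    where open ≡-Reasoning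

  term-suc : ∀ r {s} → s ≢ n → ∀ t →
    term r s (suc t) ≡ ½ ℚ.* term (suc r) (suc s) t ℚ.+ ½ ℚ.* term (suc r) (move -1# s) t
  term-suc r {s} s≢n t = trans
    -- `1ℚ - ½` computes to `½`, so both branches carry the same factor.
    (cong₂ ℚ._*_ (cong a (ℕₚ.+-suc r t)) (turnsProb-suc ½ n s≢n t))
    (solve 4 (λ h a x y → a :* (h :* x :+ h :* y) := h :* (a :* x) :+ h :* (a :* y))
      refl ½ (a (suc r ℕ.+ t)) (turnsProb ½ n (suc s) t) (turnsProb ½ n (move -1# s) t))
    where open ℚ-Solver

  error-suc : ∀ r {s} → s < n → ∀ m →
    error r s (suc m) ≡ ½ ℚ.* error (suc r) (suc s) m ℚ.+ ½ ℚ.* error (suc r) (move -1# s) m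
  error-suc r {s} s<n m = begin
    partialSum (term r s) (suc m) ℚ.- g r s
      ≡⟨ cong (ℚ._- g r s) (partialSum-suc (term r s) m) ⟩
    (term r s 0 ℚ.+ partialSum (term r s ∘ suc) m) ℚ.- g r s
      ≡⟨ cong (ℚ._- g r s) (cong₂ ℚ._+_
           (trans (cong (a (r ℕ.+ 0) ℚ.*_) (turnsProb-zero ½ n s≢n)) (ℚₚ.*-zeroʳ (a (r ℕ.+ 0))))
           (trans (partialSum-cong (term-suc r s≢n) m)
                  (partialSum-average (term (suc r) (suc s)) (term (suc r) (move -1# s)) m))) ⟩
    (0ℚ ℚ.+ (½ ℚ.* P₊ ℚ.+ ½ ℚ.* P₋)) ℚ.- g r s
      -- Writing `g r s` as half of its double makes `g-mean` applicable.
      ≡⟨ solve 3 (λ x y z → (con 0ℚ :+ (con ½ :* x :+ con ½ :* y)) :- z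
           := (con ½ :* x :+ con ½ :* y) :- con ½ :* (z :+ z)) refl P₊ P₋ (g r s) ⟩
    (½ ℚ.* P₊ ℚ.+ ½ ℚ.* P₋) ℚ.- ½ ℚ.* (g r s ℚ.+ g r s)
      ≡⟨ cong (λ x → (½ ℚ.* P₊ ℚ.+ ½ ℚ.* P₋) ℚ.- ½ ℚ.* x) (g-mean r s<n) ⟩
    (½ ℚ.* P₊ ℚ.+ ½ ℚ.* P₋) ℚ.- ½ ℚ.* (g₊ ℚ.+ g₋)
      ≡⟨ solve 5 (λ h x y u v → (h :* x :+ h :* y) :- h :* (u :+ v) := h :* (x :- u) :+ h :* (y :- v))
           refl ½ P₊ P₋ g₊ g₋ ⟩
    ½ ℚ.* (P₊ ℚ.- g₊) ℚ.+ ½ ℚ.* (P₋ ℚ.- g₋) ∎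
    where
    open ≡-Reasoning
    open ℚ-Solver
    s≢n = ℕₚ.<⇒≢ s<n
    P₊ = partialSum (term (suc r) (suc s)) m
    P₋ = partialSum (term (suc r) (move -1# s)) m
    g₊ = g (suc r) (suc s)
    g₋ = g (suc r) (move -1# s)

  -- A turn moves one unit from `m` to `r`, so the factor `r + m` is the same at both successors and
  -- passes through the average. The induction then closes because the mean of `h` does not
  -- increase.
  error-bound : ∀ m r {s} → s ≤ n → fromℕ (r ℕ.+ m) ℚ.* ℚ.∣ error r s m ∣ ℚ.≤ fromℕ (h r s)
  error-bound zero r {s} s≤n = subst (ℚ._≤ fromℕ (h r s))
    (cong₂ (λ i x → fromℕ i ℚ.* x) (sym (ℕₚ.+-identityʳ r)) (sym (error-zero r s))) (g≤h r s≤n)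
  error-bound (suc m) r {s} s≤n with ℕₚ.m≤n⇒m<n∨m≡n s≤n
  ... | inj₂ refl = begin
    fromℕ (r ℕ.+ suc m) ℚ.* ℚ.∣ error r n (suc m) ∣  ≡⟨ cong (λ x → fromℕ (r ℕ.+ suc m) ℚ.* ℚ.∣ x ∣) (error-ended r m) ⟩
    fromℕ (r ℕ.+ suc m) ℚ.* 0ℚ                       ≡⟨ ℚₚ.*-zeroʳ (fromℕ (r ℕ.+ suc m)) ⟩
    fromℕ 0                                          ≤⟨ fromℕ-mono-≤ {0} {h r n} z≤n ⟩
    fromℕ (h r n)                                    ∎
    where open ℚₚ.≤-Reasoning
  ... | inj₁ s<n = begin
    fromℕ (r ℕ.+ suc m) ℚ.* ℚ.∣ error r s (suc m) ∣
      ≡⟨ cong₂ (λ i x → fromℕ i ℚ.* ℚ.∣ x ∣) (ℕₚ.+-suc r m) (error-suc r s<n m) ⟩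
    M ℚ.* ℚ.∣ ½ ℚ.* e₊ ℚ.+ ½ ℚ.* e₋ ∣
      ≤⟨ ℚₚ.*-monoˡ-≤-nonNeg M {{fromℕ-nonNeg (suc r ℕ.+ m)}} (ℚₚ.∣p+q∣≤∣p∣+∣q∣ (½ ℚ.* e₊) (½ ℚ.* e₋)) ⟩
    M ℚ.* (ℚ.∣ ½ ℚ.* e₊ ∣ ℚ.+ ℚ.∣ ½ ℚ.* e₋ ∣)
      ≡⟨ cong₂ (λ x y → M ℚ.* (x ℚ.+ y)) (ℚₚ.∣p*q∣≡∣p∣*∣q∣ ½ e₊) (ℚₚ.∣p*q∣≡∣p∣*∣q∣ ½ e₋) ⟩
    M ℚ.* (½ ℚ.* ℚ.∣ e₊ ∣ ℚ.+ ½ ℚ.* ℚ.∣ e₋ ∣)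
      ≡⟨ solve 4 (λ k h x y → k :* (h :* x :+ h :* y) := h :* (k :* x :+ k :* y)) refl M ½ ℚ.∣ e₊ ∣ ℚ.∣ e₋ ∣ ⟩
    ½ ℚ.* (M ℚ.* ℚ.∣ e₊ ∣ ℚ.+ M ℚ.* ℚ.∣ e₋ ∣)
      ≤⟨ ℚₚ.*-monoˡ-≤-nonNeg ½ (ℚₚ.+-mono-≤ (error-bound m (suc r) s<n)
           (error-bound m (suc r) (ℕₚ.≤-trans (move-down-≤ s) s≤n))) ⟩
    ½ ℚ.* (fromℕ h₊ ℚ.+ fromℕ h₋)
      ≡⟨ cong (½ ℚ.*_) (/-homo-+ 0 (+ h₊) (+ h₋)) ⟨
    ½ ℚ.* fromℕ (h₊ ℕ.+ h₋)
      ≤⟨ ℚₚ.*-monoˡ-≤-nonNeg ½ (fromℕ-mono-≤ (h-mean r s<n)) ⟩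
    ½ ℚ.* fromℕ (h r s ℕ.+ h r s)
      ≡⟨ cong (½ ℚ.*_) (/-homo-+ 0 (+ h r s) (+ h r s)) ⟩
    ½ ℚ.* (fromℕ (h r s) ℚ.+ fromℕ (h r s))
      ≡⟨ solve 1 (λ x → con ½ :* (x :+ x) := x) refl (fromℕ (h r s)) ⟩
    fromℕ (h r s) ∎
    where
    open ℚₚ.≤-Reasoning
    open ℚ-Solver using (solve; con; _:=_; _:+_; _:*_)
    M = fromℕ (suc r ℕ.+ m)
    e₊ = error (suc r) (suc s) m
    e₋ = error (suc r) (move -1# s) m
    h₊ = h (suc r) (suc s)
    h₋ = h (suc r) (move -1# s)

  sums-to : ∀ {s} → s ≤ n → SumsTo (λ t → a t ℚ.* turnsProb ½ n s t) (g 0 s)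
  sums-to {s} s≤n ε 0<ε with archimedean (h 0 s) ε 0<ε
  ... | N , large = N , λ m N≤m →
    -- m times the error is at most `h 0 s`, which is below m ε. As the inequality is strict, a
    -- nonnegative factor can be cancelled.
    ℚₚ.*-cancelˡ-<-nonNeg (fromℕ m) {{fromℕ-nonNeg m}}
      (ℚₚ.≤-<-trans (error-bound m 0 s≤n) (large m N≤m))

-- The expected duration and the majorant along the walk

excess : ℕ → ℕ → ℕ
excess n s = n ℕ.* suc n ∸ s ℕ.* suc s

excess-≤ : ∀ n s → excess n s ≤ n ℕ.* suc n
excess-≤ n s = ℕₚ.m∸n≤m (n ℕ.* suc n) (s ℕ.* suc s)

excess-+ : ∀ {n s} → s ≤ n → excess n s ℕ.+ s ℕ.* suc s ≡ n ℕ.* suc n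
excess-+ s≤n = ℕₚ.m∸n+n≡m (ℕₚ.*-mono-≤ s≤n (s≤s s≤n))

-- Truncated subtraction is avoided by adding s (s + 1) to both sides, which turns each into n (n +
-- 1).
excess-up : ∀ {n s} → s < n → excess n s ≡ excess n (suc s) ℕ.+ (suc s ℕ.+ suc s)
excess-up {n} {s} s<n = ℕₚ.+-cancelʳ-≡ (s ℕ.* suc s) _ _ (begin
  excess n s ℕ.+ s ℕ.* suc s                                  ≡⟨ excess-+ (ℕₚ.<⇒≤ s<n) ⟩
  n ℕ.* suc n                                                 ≡⟨ excess-+ s<n ⟨
  excess n (suc s) ℕ.+ suc s ℕ.* suc (suc s)                  ≡⟨ regroup (excess n (suc s)) s ⟩
  excess n (suc s) ℕ.+ (suc s ℕ.+ suc s) ℕ.+ s ℕ.* suc s      ∎)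
  where
  open ≡-Reasoning
  regroup : ∀ v s → v ℕ.+ suc s ℕ.* suc (suc s) ≡ v ℕ.+ (suc s ℕ.+ suc s) ℕ.+ s ℕ.* suc s
  regroup = ℕ-Ring.solve-∀

-- At 0 the player stays and the increment 2 s is 0, so the boundary obeys the same formula as the
-- interior.
excess-down : ∀ {n s} → s < n → excess n (move -1# s) ≡ excess n s ℕ.+ (s ℕ.+ s)
excess-down {n} {zero}  s<n = sym (ℕₚ.+-identityʳ _)
excess-down {n} {suc s} s<n = excess-up (ℕₚ.<-trans (ℕₚ.n<1+n s) s<n)

-- As a function of the position it depends linearly on w, so its mean after one
-- turn only involves w - 1, and it decreases as soon as y ≥ 6 w.
majorant : ℕ → ℕ → ℕ
majorant y w = y ℕ.^ 4 ℕ.+ 8 ℕ.* (w ℕ.* y ℕ.^ 3)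

-- To leading order, in the mean, y⁴ gains 4 y³ while the drop of w by 1 takes away 8 y³. What is
-- left, 4 y³, absorbs the growth 24 w y² of 8 w y³ once y ≥ 6 w, which `y = 6 * w + u` encodes.
majorant-mean : ∀ u v s → let w = v ℕ.+ (suc s ℕ.+ suc s) ; y = 6 ℕ.* w ℕ.+ u in
  majorant (suc y) v ℕ.+ majorant (suc y) (w ℕ.+ (s ℕ.+ s)) ≤ majorant y w ℕ.+ majorant y w
majorant-mean u v s = subst (lhs ≤_) (identity u v s) (ℕₚ.m≤m+n lhs _)
  where
  open ℕ-Solver
  w = v ℕ.+ (suc s ℕ.+ suc s)
  y = 6 ℕ.* w ℕ.+ u
  lhs = majorant (suc y) v ℕ.+ majorant (suc y) (w ℕ.+ (s ℕ.+ s))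
  majorant′ : ∀ {n} → Polynomial n → Polynomial n → Polynomial n
  majorant′ y w = y :^ 4 :+ con 8 :* (w :* y :^ 3)
  identity : ∀ u v s → let w = v ℕ.+ (suc s ℕ.+ suc s) ; y = 6 ℕ.* w ℕ.+ u in
    majorant (suc y) v ℕ.+ majorant (suc y) (w ℕ.+ (s ℕ.+ s))
    -- Half the gap is 4 y³ + 18 y² + 20 y + 7 - 24 w y² - 24 w y - 8 w. Substituting u for y - 6 w
    -- removes all minus signs.
    ℕ.+ 2 ℕ.* (4 ℕ.* (y ℕ.* y ℕ.* u) ℕ.+ 4 ℕ.* (y ℕ.* u) ℕ.+ 14 ℕ.* (y ℕ.* y) ℕ.+ 20 ℕ.* u ℕ.+ 112 ℕ.* w ℕ.+ 7)
    ≡ majorant y w ℕ.+ majorant y w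
  identity = solve 3 (λ u v s →
    let w = v :+ ((con 1 :+ s) :+ (con 1 :+ s)) ; y = con 6 :* w :+ u in
    majorant′ (con 1 :+ y) v :+ majorant′ (con 1 :+ y) (w :+ (s :+ s))
    :+ con 2 :* (con 4 :* (y :* y :* u) :+ con 4 :* (y :* u) :+ con 14 :* (y :* y) :+ con 20 :* u :+ con 112 :* w :+ con 7)
    := majorant′ y w :+ majorant′ y w) refl

-- From integer polynomials to moments

excess-ℤ : ∀ {n s} → s ≤ n → + excess n s ≡ + n * (+ 1 + + n) - + s * (+ 1 + + s)
excess-ℤ {n} {s} s≤n = begin
  + excess n s
    ≡⟨ solve 2 (λ e z → e := (e :+ z) :- z) refl (+ excess n s) (+ (s ℕ.* suc s)) ⟩
  + (excess n s ℕ.+ s ℕ.* suc s) - + (s ℕ.* suc s)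
    ≡⟨ cong (λ x → + x - + (s ℕ.* suc s)) (excess-+ s≤n) ⟩
  + (n ℕ.* suc n) - + (s ℕ.* suc s)
    ≡⟨ cong₂ _-_ (ℤₚ.pos-* n (suc n)) (ℤₚ.pos-* s (suc s)) ⟩
  + n * (+ 1 + + n) - + s * (+ 1 + + s) ∎
  where
  open ≡-Reasoning
  open +-*-Solver

-- It rises by one with each turn, is at least 6 w for every w ≤ c, and is positive thanks to
-- `suc c`.
radius : ℕ → ℕ → ℕ
radius c r = r ℕ.+ 6 ℕ.* suc c

-- With c = n (n + 1), the expected duration from s is w = n (n + 1) - s (s + 1);
-- it is v from s + 1 and w + 2 s from the position below s (also for s = 0).
MeanValue : (ℤ → ℤ → ℤ → ℤ) → Set
MeanValue G = ∀ r v s →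
  let w = v + ((+ 1 + s) + (+ 1 + s)) ; c = w + s * (+ 1 + s) in
  G c r w + G c r w ≡ G c (+ 1 + r) v + G c (+ 1 + r) (w + (s + s))

-- `G c r w` is meant to be `suc d` times E[(r + X)^k]; clearing the denominator leaves integer
-- identities, and the position enters only through w.
module Moment
  (k d : ℕ) (k≤3 : k ≤ 3) (G : ℤ → ℤ → ℤ → ℤ)
  (G-ended : ∀ c r → G c (+ r) (+ 0) ≡ + (r ℕ.^ k) * + suc d)
  (G-mean : MeanValue G)
  (G-bound : ∀ c r w → w ≤ c → ℤ.∣ G (+ c) (+ r) (+ w) ∣ ≤ radius c r ℕ.^ k ℕ.* suc d)
  (n : ℕ)
  where

  c = n ℕ.* suc n

  value : ℕ → ℕ → ℤ
  value r s = G (+ c) (+ r) (+ excess n s)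

  value-ended : ∀ r → value r n / suc d ≡ fromℕ (r ℕ.^ k)
  value-ended r = ℚₚ.fromℚᵘ-cong {mkℚᵘ (value r n) d} {mkℚᵘ (+ (r ℕ.^ k)) 0} (*≡* (begin
    value r n * + 1                 ≡⟨ ℤₚ.*-identityʳ (value r n) ⟩
    value r n                       ≡⟨ cong (λ w → G (+ c) (+ r) (+ w)) (ℕₚ.n∸n≡0 c) ⟩
    G (+ c) (+ r) (+ 0)             ≡⟨ G-ended (+ c) r ⟩
    + (r ℕ.^ k) * + suc d           ∎))
    where open ≡-Reasoning

  -- Expressing c and w through s and the excess at s + 1 removes truncated subtraction and gives
  -- the shape required by `G-mean`.
  value-mean : ∀ r {s} → s < n → value r s + value r s ≡ value (suc r) (suc s) + value (suc r) (move -1# s)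
  value-mean r {s} s<n = begin
    value r s + value r s
      ≡⟨ cong₂ (λ x y → G x (+ r) (+ y) + G x (+ r) (+ y)) c≡ w≡ ⟩
    G C (+ r) W + G C (+ r) W
      ≡⟨ G-mean (+ r) (+ v) (+ s) ⟩
    G C (+ suc r) (+ v) + G C (+ suc r) (W + (+ s + + s))
      ≡⟨ cong₂ (λ x y → G x (+ suc r) (+ v) + G x (+ suc r) (+ y)) c≡
           (trans (excess-down s<n) (cong (ℕ._+ (s ℕ.+ s)) w≡)) ⟨
    value (suc r) (suc s) + value (suc r) (move -1# s) ∎
    where
    open ≡-Reasoning
    v = excess n (suc s)
    W = + v + ((+ 1 + + s) + (+ 1 + + s))
    C = W + + s * (+ 1 + + s)
    w≡ = excess-up s<n
    c≡ : + c ≡ C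
    c≡ = begin
      + c                                                  ≡⟨ cong +_ (excess-+ (ℕₚ.<⇒≤ s<n)) ⟨
      + excess n s + + (s ℕ.* suc s)                       ≡⟨ cong₂ (λ x y → + x + y) w≡ (ℤₚ.pos-* s (suc s)) ⟩
      C                                                    ∎

  bound : ℕ → ℕ → ℕ
  bound r s = majorant (radius c r) (excess n s)

  bound-mean : ∀ r {s} → s < n → bound (suc r) (suc s) ℕ.+ bound (suc r) (move -1# s) ≤ bound r s ℕ.+ bound r s
  bound-mean r {s} s<n = subst₂ _≤_
    (cong₂ (λ y w → majorant (suc y) v ℕ.+ majorant (suc y) w) (sym y≡)
      (sym (trans (excess-down s<n) (cong (ℕ._+ (s ℕ.+ s)) w≡))))
    (cong₂ (λ y w → majorant y w ℕ.+ majorant y w) (sym y≡) (sym w≡))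
    (majorant-mean u v s)
    where
    v = excess n (suc s)
    w = v ℕ.+ (suc s ℕ.+ suc s)
    w≡ = excess-up s<n
    -- From c = w + s (s + 1) the radius r + 6 (c + 1) is 6 w plus this remainder.
    u = r ℕ.+ 6 ℕ.* suc (s ℕ.* suc s)
    y≡ : radius c r ≡ 6 ℕ.* w ℕ.+ u
    y≡ = trans (cong (λ c → radius c r) (trans (sym (excess-+ (ℕₚ.<⇒≤ s<n))) (cong (ℕ._+ s ℕ.* suc s) w≡)))
      (solve 3 (λ r w z → r :+ con 6 :* (con 1 :+ (w :+ z)) := con 6 :* w :+ (r :+ con 6 :* (con 1 :+ z)))
        refl r w (s ℕ.* suc s))
      where open ℕ-Solver

  -- As r ≤ y, the product is at most y^(k + 1) times `suc d`. With k ≤ 3 this is covered by the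
  -- summand y⁴ of the majorant.
  value≤bound : ∀ r {s} → s ≤ n → fromℕ r ℚ.* ℚ.∣ value r s / suc d ∣ ℚ.≤ fromℕ (bound r s)
  value≤bound r {s} s≤n = fromℕ*∣/∣≤fromℕ r (value r s) d (bound r s) (begin
    r ℕ.* ℤ.∣ value r s ∣             ≤⟨ ℕₚ.*-mono-≤ (ℕₚ.m≤m+n r _) (G-bound c r (excess n s) (excess-≤ n s)) ⟩
    y ℕ.* (y ℕ.^ k ℕ.* suc d)         ≡⟨ ℕₚ.*-assoc y (y ℕ.^ k) (suc d) ⟨
    y ℕ.^ suc k ℕ.* suc d             ≤⟨ ℕₚ.*-monoˡ-≤ (suc d) (ℕₚ.^-monoʳ-≤ y (s≤s k≤3)) ⟩
    y ℕ.^ 4 ℕ.* suc d                 ≤⟨ ℕₚ.*-monoˡ-≤ (suc d) (ℕₚ.m≤m+n (y ℕ.^ 4) _) ⟩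
    bound r s ℕ.* suc d               ∎)
    where
    open ℕₚ.≤-Reasoning
    y = radius c r
    instance
      y≢0 : ℕ.NonZero y
      y≢0 = ℕ.>-nonZero (ℕₚ.<-≤-trans (s≤s z≤n) (ℕₚ.m≤n+m (6 ℕ.* suc c) r))

  moment : ∀ {s} → s ≤ n → SumsTo (λ t → fromℕ (t ℕ.^ k) ℚ.* turnsProb ½ n s t) (value 0 s / suc d)
  moment = Approximation.sums-to n (λ t → fromℕ (t ℕ.^ k)) (λ r s → value r s / suc d) bound
    value-ended mean bound-mean value≤bound
    where
    mean : ∀ r {s} → s < n → value r s / suc d ℚ.+ value r s / suc d
                           ≡ value (suc r) (suc s) / suc d ℚ.+ value (suc r) (move -1# s) / suc d
    mean r {s} s<n = begin
      value r s / suc d ℚ.+ value r s / suc d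
        ≡⟨ /-homo-+ d (value r s) (value r s) ⟨
      (value r s + value r s) / suc d
        ≡⟨ cong (_/ suc d) (value-mean r s<n) ⟩
      (value (suc r) (suc s) + value (suc r) (move -1# s)) / suc d
        ≡⟨ /-homo-+ d (value (suc r) (suc s)) (value (suc r) (move -1# s)) ⟩
      value (suc r) (suc s) / suc d ℚ.+ value (suc r) (move -1# s) / suc d ∎
      where open ≡-Reasoning

-- Size of the moment polynomials

-- A record, because the ℤ.∣ i ∣ ≤ a of a compound i would unfold before unification.
record ∣_∣⊑_ (i : ℤ) (a : ℕ) : Set where
  constructor bounded
  field ∣i∣≤a : ℤ.∣ i ∣ ≤ a

open ∣_∣⊑_

-- The combinators follow the syntax of a polynomial: the resulting bound has every minus sign
-- turned into plus and every variable replaced by its bound.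
module Bounds where
  infixl 6 _⊕_ _⊖_
  infixl 7 _⊗_

  _⊕_ : ∀ {i j a b} → ∣ i ∣⊑ a → ∣ j ∣⊑ b → ∣ i + j ∣⊑ (a ℕ.+ b)
  _⊕_ {i} {j} (bounded p) (bounded q) = bounded (ℕₚ.≤-trans (ℤₚ.∣i+j∣≤∣i∣+∣j∣ i j) (ℕₚ.+-mono-≤ p q))

  _⊖_ : ∀ {i j a b} → ∣ i ∣⊑ a → ∣ j ∣⊑ b → ∣ i - j ∣⊑ (a ℕ.+ b)
  _⊖_ {i} {j} (bounded p) (bounded q) = bounded (ℕₚ.≤-trans (ℤₚ.∣i-j∣≤∣i∣+∣j∣ i j) (ℕₚ.+-mono-≤ p q))

  _⊗_ : ∀ {i j a b} → ∣ i ∣⊑ a → ∣ j ∣⊑ b → ∣ i * j ∣⊑ (a ℕ.* b)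
  _⊗_ {i} {j} (bounded p) (bounded q) = bounded (ℕₚ.≤-trans (ℕₚ.≤-reflexive (ℤₚ.abs-* i j)) (ℕₚ.*-mono-≤ p q))

  literal : ∀ m → ∣ + m ∣⊑ m
  literal m = bounded ℕₚ.≤-refl

-- 3 E[(r + X)²] and 15 E[(r + X)³] in terms of c = n (n + 1) and w = E[X].
G₂ : ℤ → ℤ → ℤ → ℤ
G₂ c r w = + 3 * (r * r) + + 6 * (r * w) + w * (+ 4 * c + w - + 1)

G₃ : ℤ → ℤ → ℤ → ℤ
G₃ c r w =
  + 15 * (r * r * r) + + 45 * (r * r * w) + + 15 * (r * w * (+ 4 * c + w - + 1))
  + w * (+ 48 * (c * c) + + 12 * (c * w) + w * w - + 16 * c - + 7 * w - + 3)

G₂-bound : ∀ c r w → w ≤ c → ℤ.∣ G₂ (+ c) (+ r) (+ w) ∣ ≤ radius c r ℕ.^ 2 ℕ.* 3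
G₂-bound c r w w≤c = ℕₚ.≤-trans (∣i∣≤a sizes) (subst (size ≤_) (identity c r) (ℕₚ.m≤m+n size _))
  where
  open Bounds
  ∣c∣ = literal c
  ∣r∣ = literal r
  ∣w∣ : ∣ + w ∣⊑ c
  ∣w∣ = bounded w≤c
  sizes = literal 3 ⊗ (∣r∣ ⊗ ∣r∣) ⊕ literal 6 ⊗ (∣r∣ ⊗ ∣w∣) ⊕ ∣w∣ ⊗ (literal 4 ⊗ ∣c∣ ⊕ ∣w∣ ⊖ literal 1)
  size = 3 ℕ.* (r ℕ.* r) ℕ.+ 6 ℕ.* (r ℕ.* c) ℕ.+ c ℕ.* (4 ℕ.* c ℕ.+ c ℕ.+ 1)
  identity : ∀ c r →
    3 ℕ.* (r ℕ.* r) ℕ.+ 6 ℕ.* (r ℕ.* c) ℕ.+ c ℕ.* (4 ℕ.* c ℕ.+ c ℕ.+ 1)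
    -- The difference of 3 (r + 6 (c + 1))² and `size`; its coefficients are all nonnegative. The
    -- cubic case below is analogous.
    ℕ.+ (r ℕ.* (30 ℕ.* c ℕ.+ 36) ℕ.+ (103 ℕ.* (c ℕ.* c) ℕ.+ 215 ℕ.* c ℕ.+ 108))
    ≡ radius c r ℕ.^ 2 ℕ.* 3
  identity = solve 2 (λ c r →
    con 3 :* (r :* r) :+ con 6 :* (r :* c) :+ c :* (con 4 :* c :+ c :+ con 1)
    :+ (r :* (con 30 :* c :+ con 36) :+ (con 103 :* (c :* c) :+ con 215 :* c :+ con 108))
    := (r :+ con 6 :* (con 1 :+ c)) :^ 2 :* con 3) refl
    where open ℕ-Solver

G₃-bound : ∀ c r w → w ≤ c → ℤ.∣ G₃ (+ c) (+ r) (+ w) ∣ ≤ radius c r ℕ.^ 3 ℕ.* 15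
G₃-bound c r w w≤c = ℕₚ.≤-trans (∣i∣≤a sizes) (subst (size ≤_) (identity c r) (ℕₚ.m≤m+n size _))
  where
  open Bounds
  ∣c∣ = literal c
  ∣r∣ = literal r
  ∣w∣ : ∣ + w ∣⊑ c
  ∣w∣ = bounded w≤c
  sizes = literal 15 ⊗ (∣r∣ ⊗ ∣r∣ ⊗ ∣r∣) ⊕ literal 45 ⊗ (∣r∣ ⊗ ∣r∣ ⊗ ∣w∣)
    ⊕ literal 15 ⊗ (∣r∣ ⊗ ∣w∣ ⊗ (literal 4 ⊗ ∣c∣ ⊕ ∣w∣ ⊖ literal 1))
    ⊕ ∣w∣ ⊗ (literal 48 ⊗ (∣c∣ ⊗ ∣c∣) ⊕ literal 12 ⊗ (∣c∣ ⊗ ∣w∣) ⊕ ∣w∣ ⊗ ∣w∣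
           ⊖ literal 16 ⊗ ∣c∣ ⊖ literal 7 ⊗ ∣w∣ ⊖ literal 3)
  size = 15 ℕ.* (r ℕ.* r ℕ.* r) ℕ.+ 45 ℕ.* (r ℕ.* r ℕ.* c) ℕ.+ 15 ℕ.* (r ℕ.* c ℕ.* (4 ℕ.* c ℕ.+ c ℕ.+ 1))
    ℕ.+ c ℕ.* (48 ℕ.* (c ℕ.* c) ℕ.+ 12 ℕ.* (c ℕ.* c) ℕ.+ c ℕ.* c ℕ.+ 16 ℕ.* c ℕ.+ 7 ℕ.* c ℕ.+ 3)
  identity : ∀ c r →
    15 ℕ.* (r ℕ.* r ℕ.* r) ℕ.+ 45 ℕ.* (r ℕ.* r ℕ.* c) ℕ.+ 15 ℕ.* (r ℕ.* c ℕ.* (4 ℕ.* c ℕ.+ c ℕ.+ 1))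
    ℕ.+ c ℕ.* (48 ℕ.* (c ℕ.* c) ℕ.+ 12 ℕ.* (c ℕ.* c) ℕ.+ c ℕ.* c ℕ.+ 16 ℕ.* c ℕ.+ 7 ℕ.* c ℕ.+ 3)
    ℕ.+ (r ℕ.* r ℕ.* (225 ℕ.* c ℕ.+ 270) ℕ.+ r ℕ.* (1545 ℕ.* (c ℕ.* c) ℕ.+ 3225 ℕ.* c ℕ.+ 1620)
      ℕ.+ (3179 ℕ.* (c ℕ.* c ℕ.* c) ℕ.+ 9697 ℕ.* (c ℕ.* c) ℕ.+ 9717 ℕ.* c ℕ.+ 3240))
    ≡ radius c r ℕ.^ 3 ℕ.* 15
  identity = solve 2 (λ c r →
    con 15 :* (r :* r :* r) :+ con 45 :* (r :* r :* c) :+ con 15 :* (r :* c :* (con 4 :* c :+ c :+ con 1))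
    :+ c :* (con 48 :* (c :* c) :+ con 12 :* (c :* c) :+ c :* c :+ con 16 :* c :+ con 7 :* c :+ con 3)
    :+ (r :* r :* (con 225 :* c :+ con 270) :+ r :* (con 1545 :* (c :* c) :+ con 3225 :* c :+ con 1620)
      :+ (con 3179 :* (c :* c :* c) :+ con 9697 :* (c :* c) :+ con 9717 :* c :+ con 3240))
    := (r :+ con 6 :* (con 1 :+ c)) :^ 3 :* con 15) refl
    where open ℕ-Solver

-- Identities for the second and third moments

module _ where
  open +-*-Solver

  G₂′ G₃′ : ∀ {m} → Polynomial m → Polynomial m → Polynomial m → Polynomial m
  G₂′ c r w = con (+ 3) :* (r :* r) :+ con (+ 6) :* (r :* w) :+ w :* (con (+ 4) :* c :+ w :- con (+ 1))
  G₃′ c r w =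
    con (+ 15) :* (r :* r :* r) :+ con (+ 45) :* (r :* r :* w) :+ con (+ 15) :* (r :* w :* (con (+ 4) :* c :+ w :- con (+ 1)))
    :+ w :* (con (+ 48) :* (c :* c) :+ con (+ 12) :* (c :* w) :+ w :* w :- con (+ 16) :* c :- con (+ 7) :* w :- con (+ 3))

  G₂-ended : ∀ c r → G₂ c (+ r) (+ 0) ≡ + (r ℕ.^ 2) * + 3
  G₂-ended c r = trans
    -- `r ℕ.^ 2` unfolds to `r * (r * 1)`; keeping this shape lets `pos-*` be applied factor by
    -- factor.
    (solve 2 (λ c r → G₂′ c r (con (+ 0)) := r :* (r :* con (+ 1)) :* con (+ 3)) refl c (+ r))
    (cong (_* + 3) (sym (trans (ℤₚ.pos-* r (r ℕ.* 1)) (cong (+ r *_) (ℤₚ.pos-* r 1)))))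

  G₃-ended : ∀ c r → G₃ c (+ r) (+ 0) ≡ + (r ℕ.^ 3) * + 15
  G₃-ended c r = trans
    (solve 2 (λ c r → G₃′ c r (con (+ 0)) := r :* (r :* (r :* con (+ 1))) :* con (+ 15)) refl c (+ r))
    (cong (_* + 15) (sym (trans (ℤₚ.pos-* r (r ℕ.^ 2)) (cong (+ r *_)
      (trans (ℤₚ.pos-* r (r ℕ.^ 1)) (cong (+ r *_) (ℤₚ.pos-* r 1)))))))

  -- The increments of w, namely -2 (s + 1) and 2 s, have sum -2 and product -4 s (s + 1) = -4 (c -
  -- w). Averaging a polynomial in c and w over them therefore gives one in c and w again; the same
  -- holds for `G₃`.
  G₂-mean : MeanValue G₂
  G₂-mean = solve 3 (λ r v s →
    let w = v :+ ((con (+ 1) :+ s) :+ (con (+ 1) :+ s)) ; c = w :+ s :* (con (+ 1) :+ s) in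
    G₂′ c r w :+ G₂′ c r w := G₂′ c (con (+ 1) :+ r) v :+ G₂′ c (con (+ 1) :+ r) (w :+ (s :+ s))) refl

  G₃-mean : MeanValue G₃
  G₃-mean = solve 3 (λ r v s →
    let w = v :+ ((con (+ 1) :+ s) :+ (con (+ 1) :+ s)) ; c = w :+ s :* (con (+ 1) :+ s) in
    G₃′ c r w :+ G₃′ c r w := G₃′ c (con (+ 1) :+ r) v :+ G₃′ c (con (+ 1) :+ r) (w :+ (s :+ s))) refl

  -- (N - S) (N + S + 1) is w, and the last factor is 4 c + w - 1.
  G₂-closed : ∀ N S → let c = N * (+ 1 + N) in
    G₂ c (+ 0) (c - S * (+ 1 + S))
    ≡ (N - S) * (N + S + + 1) * (+ 5 * N ^ 2 + + 5 * N - S ^ 2 - S - + 1)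
  G₂-closed = solve 2 (λ N S → let c = N :* (con (+ 1) :+ N) in
    G₂′ c (con (+ 0)) (c :- S :* (con (+ 1) :+ S))
    := (N :- S) :* (N :+ S :+ con (+ 1)) :* (con (+ 5) :* N :^ 2 :+ con (+ 5) :* N :- S :^ 2 :- S :- con (+ 1))) refl

  G₃-closed : ∀ N S → let c = N * (+ 1 + N) in
    G₃ c (+ 0) (c - S * (+ 1 + S))
    ≡ (N - S) * (N + S + + 1)
      * (+ 61 * N ^ 4 + + 122 * N ^ 3
         - (+ 14 * S ^ 2 + + 14 * S - + 38) * N ^ 2
         - (+ 14 * S ^ 2 + + 14 * S + + 23) * N
         + S ^ 4 + + 2 * S ^ 3 + + 8 * S ^ 2 + + 7 * S - + 3)
  G₃-closed = solve 2 (λ N S → let c = N :* (con (+ 1) :+ N) in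
    G₃′ c (con (+ 0)) (c :- S :* (con (+ 1) :+ S))
    := (N :- S) :* (N :+ S :+ con (+ 1))
       :* (con (+ 61) :* N :^ 4 :+ con (+ 122) :* N :^ 3
           :- (con (+ 14) :* S :^ 2 :+ con (+ 14) :* S :- con (+ 38)) :* N :^ 2
           :- (con (+ 14) :* S :^ 2 :+ con (+ 14) :* S :+ con (+ 23)) :* N
           :+ S :^ 4 :+ con (+ 2) :* S :^ 3 :+ con (+ 8) :* S :^ 2 :+ con (+ 7) :* S :- con (+ 3))) refl

-- Almost sure termination and the two moments

turnsProb-total : ∀ {n s} → s ≤ n → SumsTo (turnsProb ½ n s) 1ℚ
turnsProb-total {n} {s} s≤n = SumsTo-cong {l = 1ℚ} (λ t → ℚₚ.*-identityˡ (turnsProb ½ n s t))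
  -- Termination is the zeroth moment, with `G` constantly 1, so it follows from the same
  -- convergence argument.
  (Moment.moment 0 0 z≤n (λ _ _ _ → + 1) (λ _ _ → refl) (λ _ _ _ → refl) (λ _ _ _ _ → ℕₚ.≤-refl) n s≤n)

proposition5 :
    ∀ (n s : ℕ) → s ≤ n →
    let N = + n
        S = + s
    in
    IsMoment (turnsProb ½ n s) 2
      (((N - S) * (N + S + + 1) * (+ 5 * N ^ 2 + + 5 * N - S ^ 2 - S - + 1)) / 3)
    ×
    IsMoment (turnsProb ½ n s) 3
      (((N - S) * (N + S + + 1)
        * (+ 61 * N ^ 4 + + 122 * N ^ 3
           - (+ 14 * S ^ 2 + + 14 * S - + 38) * N ^ 2
           - (+ 14 * S ^ 2 + + 14 * S + + 23) * N
           + S ^ 4 + + 2 * S ^ 3 + + 8 * S ^ 2 + + 7 * S - + 3)) / 15)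
proposition5 n s s≤n =
  -- The second argument of `Moment.moment` is the denominator less one: 2 for 3, and 14 for 15.
  (turnsProb-total s≤n , subst (SumsTo _) (cong (_/ 3) (closed G₂ G₂-closed))
    (Moment.moment 2 2 (s≤s (s≤s z≤n)) G₂ G₂-ended G₂-mean G₂-bound n s≤n)) ,
  (turnsProb-total s≤n , subst (SumsTo _) (cong (_/ 15) (closed G₃ G₃-closed))
    (Moment.moment 3 14 ℕₚ.≤-refl G₃ G₃-ended G₃-mean G₃-bound n s≤n))
  where
  closed : ∀ (G : ℤ → ℤ → ℤ → ℤ) {F : ℤ → ℤ → ℤ} →
    (∀ N S → let c = N * (+ 1 + N) in G c (+ 0) (c - S * (+ 1 + S)) ≡ F N S) →
    G (+ (n ℕ.* suc n)) (+ 0) (+ excess n s) ≡ F (+ n) (+ s)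
  closed G eq = trans (cong₂ (λ c w → G c (+ 0) w) (ℤₚ.pos-* n (suc n)) (excess-ℤ s≤n)) (eq (+ n) (+ s))
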